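{- For every integer $k\geq 2$, the graph $H_{2k-3}$ satisfies $w(H_{2k-3})=2k-1$, $2|L_o(H_{2k-3})|+1=\ell_o(H_{2k-3})=2k+1$, and $\chi(H_{2k-3})=2k$. In particular $w(H_{2k-3})=2|L_o(H_{2k-3})|-1$ but $\chi(H_{2k-3})=2|L_o(H_{2k-3})|=\ell_o(H_{2k-3})-1$.
   Context: For an integer $i\geq 1$, $H_i$ denotes the graph obtained from the disjoint union of the complete graph $K_i$ and the 5-cycle $C_5$ by adding all edges between $K_i$ and $C_5$. $L_o(G)$ denotes the set of all odd integers $m$ such that $G$ contains a cycle of length $m$, and $\ell_o(G)$ the length of a longest odd cycle of a non-bipartite graph $G$. $w(G)$ denotes the clique number (the number of vertices of a largest clique) and $\chi(G)$ the chromatic number. -}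

module Defs where

open import Data.Fin using (Fin; toℕ)
open import Data.List using (List; length)
open import Data.List.Membership.Propositional using (_∈_)
open import Data.List.Relation.Unary.Unique.Propositional using (Unique)
open import Data.Nat using (ℕ; suc; _*_; _+_; _≤_; z≤n; s≤s)
open import Data.Nat.Properties using (1+n≢n)
open import Data.Product using (Σ-syntax; ∃-syntax; _×_; _,_)
open import Data.Sum using (_⊎_; inj₁; inj₂; swap)
open import Data.Unit using (⊤; tt)
open import Function using (_⇔_)
open import Function.Definitions using (Injective)
open import Level using (0ℓ)
open import Relation.Binary using (Rel; Symmetric)
open import Relation.Binary.PropositionalEquality using (_≡_; _≢_; refl; sym; trans; cong; ≢-sym)
open import Relation.Nullary using (¬_)
open import Relation.Unary using (Pred)

record Graph : Set₁ where
  field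
    V      : Set
    _~_    : Rel V 0ℓ
    ~-sym  : Symmetric _~_
    ~-irr  : ∀ {v} → ¬ (v ~ v)

open Graph

K : ℕ → Graph
K n = record
  { V     = Fin n
  ; _~_   = _≢_
  ; ~-sym = ≢-sym
  ; ~-irr = λ v≢v → v≢v refl
  }

-- j is the cyclic successor of i, i.e. j = i + 1 modulo n.
Next : ∀ {n} → Rel (Fin n) 0ℓ
Next {n} i j = (toℕ j ≡ suc (toℕ i)) ⊎ (suc (toℕ i) ≡ n × toℕ j ≡ 0)

Next-irr : ∀ {n} → 3 ≤ n → {i : Fin n} → ¬ Next i i
Next-irr _ (inj₁ i≡1+i) = 1+n≢n (sym i≡1+i)
Next-irr (s≤s (s≤s _)) (inj₂ (1+i≡n , i≡0)) with trans (sym 1+i≡n) (cong suc i≡0)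
... | ()

C : (n : ℕ) → 3 ≤ n → Graph
C n 3≤n = record
  { V     = Fin n
  ; _~_   = λ i j → Next i j ⊎ Next j i
  ; ~-sym = swap
  ; ~-irr = λ { (inj₁ p) → Next-irr 3≤n p ; (inj₂ p) → Next-irr 3≤n p }
  }

module _ (G H : Graph) where

  JoinAdj : Rel (V G ⊎ V H) 0ℓ
  JoinAdj (inj₁ u) (inj₁ v) = _~_ G u v
  JoinAdj (inj₁ _) (inj₂ _) = ⊤
  JoinAdj (inj₂ _) (inj₁ _) = ⊤
  JoinAdj (inj₂ u) (inj₂ v) = _~_ H u v

  JoinAdj-sym : Symmetric JoinAdj
  JoinAdj-sym {inj₁ _} {inj₁ _} p = ~-sym G p
  JoinAdj-sym {inj₁ _} {inj₂ _} p = tt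
  JoinAdj-sym {inj₂ _} {inj₁ _} p = tt
  JoinAdj-sym {inj₂ _} {inj₂ _} p = ~-sym H p

  JoinAdj-irr : ∀ {v} → ¬ JoinAdj v v
  JoinAdj-irr {inj₁ _} = ~-irr G
  JoinAdj-irr {inj₂ _} = ~-irr H

  join : Graph
  join = record
    { V     = V G ⊎ V H
    ; _~_   = JoinAdj
    ; ~-sym = λ {u} {v} → JoinAdj-sym {u} {v}
    ; ~-irr = λ {v} → JoinAdj-irr {v}
    }

H : ℕ → Graph
H i = join (K i) (C 5 (s≤s (s≤s (s≤s z≤n))))

-- F is isomorphic to a (not necessarily induced) subgraph of G.
_⊑_ : Graph → Graph → Set
F ⊑ G = Σ[ f ∈ (V F → V G) ]
          Injective _≡_ _≡_ f × (∀ {u v} → _~_ F u v → _~_ G (f u) (f v))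

HasClique : Graph → Pred ℕ 0ℓ
HasClique G s = K s ⊑ G

HasCycle : Graph → Pred ℕ 0ℓ
HasCycle G m = Σ[ 3≤m ∈ 3 ≤ m ] (C m 3≤m ⊑ G)

Colourable : Graph → Pred ℕ 0ℓ
Colourable G c = Σ[ f ∈ (V G → Fin c) ] (∀ {u v} → _~_ G u v → f u ≢ f v)

Odd : Pred ℕ 0ℓ
Odd m = ∃[ j ] m ≡ 2 * j + 1

Lₒ : Graph → Pred ℕ 0ℓ
Lₒ G m = Odd m × HasCycle G m

-- The numerical invariants are given as relations "the invariant of G exists
-- and equals n"; each determines n uniquely.

IsGreatest : Pred ℕ 0ℓ → Pred ℕ 0ℓ
IsGreatest P n = P n × (∀ {m} → P m → m ≤ n)

IsLeast : Pred ℕ 0ℓ → Pred ℕ 0ℓ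
IsLeast P n = P n × (∀ {m} → P m → n ≤ m)

IsCliqueNumber : Graph → Pred ℕ 0ℓ
IsCliqueNumber G = IsGreatest (HasClique G)

IsChromaticNumber : Graph → Pred ℕ 0ℓ
IsChromaticNumber G = IsLeast (Colourable G)

IsLongestOddCycleLength : Graph → Pred ℕ 0ℓ
IsLongestOddCycleLength G = IsGreatest (Lₒ G)

-- The elements of P are enumerated without repetition by a list of length n.
-- (A bijection Fin n ↔ ∃ P would instead count the proofs of P m.)
HasCardinality : Pred ℕ 0ℓ → Pred ℕ 0ℓ
HasCardinality P n =
  Σ[ xs ∈ List ℕ ] Unique xs × (∀ m → m ∈ xs ⇔ P m) × length xs ≡ n

{-# OPTIONS --safe #-}

-- Joining a graph with K i raises both the clique number and the chromatic
-- number by exactly i, and C₅ has clique number 2 and chromatic number 3.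
-- For the cycles, walk through H (suc i) by starting at a vertex of the complete
-- part, going around C₅, and then visiting the remaining complete part: every
-- initial segment closes up because the first vertex is adjacent to all others,
-- so H (suc i) has cycles of all lengths from 3 to its order.

module Submission where

open import Data.Empty using (⊥-elim)
open import Data.Fin using (Fin; zero; suc; toℕ; inject≤; punchIn; punchOut; splitAt; _↑ˡ_; _↑ʳ_)
import Data.Fin as Fin
open import Data.Fin.Patterns
open import Data.Fin.Properties
  using (_≟_; all?; any?; inject≤-injective; toℕ-inject≤; injective⇒≤; punchInᵢ≢i;
         punchIn-injective; punchOut-injective; join-splitAt; splitAt-join;
         suc-injective)
open import Data.List using (map; upTo)
open import Data.List.Membership.Propositional using (_∈_)
open import Data.List.Membership.Propositional.Properties using (∈-map⁺; ∈-map⁻; ∈-upTo⁺; ∈-upTo⁻)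
open import Data.List.Properties using (length-map; length-upTo)
open import Data.List.Relation.Unary.Unique.Propositional.Properties using (map⁺; upTo⁺)
open import Data.Nat using (ℕ; zero; suc; _+_; _*_; _∸_; _≤_; _<_; z≤n; s≤s; s≤s⁻¹)
import Data.Nat.Properties as ℕ
open import Data.Product using (∃-syntax; _×_; _,_)
open import Data.Sum using (_⊎_; inj₁; inj₂; map₁; map₂)
open import Data.Sum.Properties using (inj₁-injective; inj₂-injective)
open import Data.Unit using (tt)
open import Function using (_∘_; mk⇔)
open import Function.Definitions using (Injective)
open import Relation.Binary.PropositionalEquality
  using (_≡_; _≢_; refl; sym; trans; cong; subst)
open import Relation.Nullary using (¬_; Dec; yes; no)
open import Relation.Nullary.Decidable using (¬?; _×-dec_; _⊎-dec_; _→-dec_; from-yes; decidable-stable)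
open import Defs

open Graph

C₅ : Graph
C₅ = C 5 (s≤s (s≤s (s≤s z≤n)))

splitAt-injective : ∀ m {n} → Injective _≡_ _≡_ (splitAt m {n})
splitAt-injective m {n} {x} {y} eq =
  trans (sym (join-splitAt m n x)) (trans (cong (Fin.join m n) eq) (join-splitAt m n y))

join-injective : ∀ m n → Injective _≡_ _≡_ (Fin.join m n)
join-injective m n {x} {y} eq =
  trans (sym (splitAt-join m n x)) (trans (cong (splitAt m) eq) (splitAt-join m n y))

-- Adjacency is irreflexive, so a map sending distinct indices to adjacent vertices cannot identify
-- any two of them; this spares later constructions an injectivity proof.
clique : ∀ G {s} (f : Fin s → V G) → (∀ {u v} → u ≢ v → _~_ G (f u) (f v)) → HasClique G s
clique G f adj = f , inj , adj
  where
  inj : Injective _≡_ _≡_ f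
  inj {x} {y} fx≡fy = decidable-stable (x ≟ y)
    λ x≢y → ~-irr G (subst (_~_ G (f x)) (sym fx≡fy) (adj x≢y))

-- Clique and chromatic numbers of a join with a complete graph

module _ (G : Graph) where

  clique-join⁺ : ∀ i {s} → HasClique G s → HasClique (join (K i) G) (i + s)
  clique-join⁺ i {s} (f , _ , adj) =
    clique (join (K i) G) (map₂ f ∘ splitAt i)
      λ {u} {v} u≢v → adj′ (splitAt i u) (splitAt i v) (u≢v ∘ splitAt-injective i)
    where
    adj′ : (a b : Fin i ⊎ Fin s) → a ≢ b → _~_ (join (K i) G) (map₂ f a) (map₂ f b)
    adj′ (inj₁ _) (inj₁ _) a≢b = a≢b ∘ cong inj₁
    adj′ (inj₁ _) (inj₂ _) _   = tt
    adj′ (inj₂ _) (inj₁ _) _   = tt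
    adj′ (inj₂ _) (inj₂ _) a≢b = adj (a≢b ∘ cong inj₂)

  colouring-join⁺ : ∀ i {c} → Colourable G c → Colourable (join (K i) G) (i + c)
  colouring-join⁺ i {c} (f , proper) = Fin.join i c ∘ map₂ f ,
    λ {u} {v} u~v → proper′ u v u~v ∘ join-injective i c
    where
    proper′ : ∀ u v → _~_ (join (K i) G) u v → map₂ f u ≢ map₂ f v
    proper′ (inj₁ _) (inj₁ _) u≢v = u≢v ∘ inj₁-injective
    proper′ (inj₁ _) (inj₂ _) _   ()
    proper′ (inj₂ _) (inj₁ _) _   ()
    proper′ (inj₂ _) (inj₂ _) u~v = proper u~v ∘ inj₂-injective

  module _ {i : ℕ} where

    apex : V (join (K (suc i)) G)
    apex = inj₁ zero

    apex? : ∀ v → Dec (v ≡ apex)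
    apex? (inj₁ zero)    = yes refl
    apex? (inj₁ (suc _)) = no λ ()
    apex? (inj₂ _)       = no λ ()

    lower : ∀ v → v ≢ apex → V (join (K i) G)
    lower (inj₁ zero)    v≢apex = ⊥-elim (v≢apex refl)
    lower (inj₁ (suc x)) _      = inj₁ x
    lower (inj₂ y)       _      = inj₂ y

    lower-adj : ∀ u v (p : u ≢ apex) (q : v ≢ apex) →
                _~_ (join (K (suc i)) G) u v → _~_ (join (K i) G) (lower u p) (lower v q)
    lower-adj (inj₁ zero)    _              p _ _   = ⊥-elim (p refl)
    lower-adj _              (inj₁ zero)    _ q _   = ⊥-elim (q refl)
    lower-adj (inj₁ (suc _)) (inj₁ (suc _)) _ _ u≢v = u≢v ∘ cong suc
    lower-adj (inj₁ (suc _)) (inj₂ _)       _ _ _   = tt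
    lower-adj (inj₂ _)       (inj₁ (suc _)) _ _ _   = tt
    lower-adj (inj₂ _)       (inj₂ _)       _ _ u~v = u~v

    raise : V (join (K i) G) → V (join (K (suc i)) G)
    raise = map₁ suc

    raise-adj : ∀ u v → _~_ (join (K i) G) u v → _~_ (join (K (suc i)) G) (raise u) (raise v)
    raise-adj (inj₁ _) (inj₁ _) u≢v = u≢v ∘ suc-injective
    raise-adj (inj₁ _) (inj₂ _) _   = tt
    raise-adj (inj₂ _) (inj₁ _) _   = tt
    raise-adj (inj₂ _) (inj₂ _) u~v = u~v

    apex~raise : ∀ v → _~_ (join (K (suc i)) G) apex (raise v)
    apex~raise (inj₁ _) = λ ()
    apex~raise (inj₂ _) = tt

    -- Deleting the apex costs a clique at most one vertex. If the clique meets the apex at index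
    -- `p`, then `punchIn p` skips exactly that index.
    clique-lower : ∀ {s} → HasClique (join (K (suc i)) G) (suc s) → HasClique (join (K i) G) s
    clique-lower {s} (f , inj , adj) with any? (apex? ∘ f)
    ... | yes (p , fp≡apex) = clique (join (K i) G) (λ x → lower (f (punchIn p x)) (avoids x))
      λ {u} {v} u≢v → lower-adj _ _ (avoids u) (avoids v) (adj (u≢v ∘ punchIn-injective p u v))
      where
      avoids : ∀ x → f (punchIn p x) ≢ apex
      avoids x eq = punchInᵢ≢i p x (inj (trans eq (sym fp≡apex)))
    -- The clique already avoids the apex; `f zero` is discarded only to bring the size down to `s`.
    ... | no ∄apex = clique (join (K i) G) (λ x → lower (f (suc x)) (avoids (suc x)))
      λ {u} {v} u≢v → lower-adj _ _ (avoids (suc u)) (avoids (suc v)) (adj (u≢v ∘ suc-injective))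
      where
      avoids : ∀ x → f x ≢ apex
      avoids x eq = ∄apex (x , eq)

    -- The apex is adjacent to every other vertex, so its colour occurs nowhere else and `punchOut`
    -- can delete it from the palette.
    colouring-lower : ∀ {c} → Colourable (join (K (suc i)) G) (suc c) → Colourable (join (K i) G) c
    colouring-lower (f , proper) = (λ v → punchOut (fresh v)) ,
      λ {u} {v} u~v → proper {raise u} {raise v} (raise-adj u v u~v)
                        ∘ punchOut-injective (fresh u) (fresh v)
      where
      fresh : ∀ v → f apex ≢ f (raise v)
      fresh v = proper {apex} {raise v} (apex~raise v)

  clique-join-≤ : ∀ {w} → (∀ {s} → HasClique G s → s ≤ w) →
                  ∀ i {s} → HasClique (join (K i) G) s → s ≤ i + w
  clique-join-≤ bound zero (f , _ , adj) =
    bound (clique G (drop ∘ f) λ {u} {v} u≢v → drop-adj (f u) (f v) (adj u≢v))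
    where
    drop : Fin 0 ⊎ V G → V G
    drop (inj₂ y) = y
    drop-adj : ∀ u v → _~_ (join (K 0) G) u v → _~_ G (drop u) (drop v)
    drop-adj (inj₂ _) (inj₂ _) u~v = u~v
  clique-join-≤ bound (suc i) {zero}  _  = z≤n
  clique-join-≤ bound (suc i) {suc s} cl = s≤s (clique-join-≤ bound i (clique-lower cl))

  colouring-join-≥ : ∀ {χ} → (∀ {c} → Colourable G c → χ ≤ c) →
                     ∀ i {c} → Colourable (join (K i) G) c → i + χ ≤ c
  colouring-join-≥ bound zero (f , proper) = bound (f ∘ inj₂ , proper)
  -- With no colours available, even the apex cannot be coloured.
  colouring-join-≥ bound (suc i) {zero}  (f , _) with () ← f (inj₁ zero)
  colouring-join-≥ bound (suc i) {suc c} col = s≤s (colouring-join-≥ bound i (colouring-lower col))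

  cliqueNumber-join : ∀ i {w} → IsCliqueNumber G w → IsCliqueNumber (join (K i) G) (i + w)
  cliqueNumber-join i (has , bound) = clique-join⁺ i has , clique-join-≤ bound i

  chromaticNumber-join : ∀ i {χ} → IsChromaticNumber G χ → IsChromaticNumber (join (K i) G) (i + χ)
  chromaticNumber-join i (has , bound) = colouring-join⁺ i has , colouring-join-≥ bound i

-- The 5-cycle: clique number 2 and chromatic number 3

Next? : ∀ {n} (i j : Fin n) → Dec (Next i j)
Next? {n} i j = (toℕ j ℕ.≟ suc (toℕ i)) ⊎-dec ((suc (toℕ i) ℕ.≟ n) ×-dec (toℕ j ℕ.≟ 0))

C₅-adj? : ∀ u v → Dec (_~_ C₅ u v)
C₅-adj? u v = Next? u v ⊎-dec Next? v u

-- Adjacency is decidable, so this is settled by evaluating all triples of vertices.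
C₅-triangle-free : ∀ u v w → _~_ C₅ u v → _~_ C₅ v w → ¬ _~_ C₅ u w
C₅-triangle-free = from-yes (all? λ u → all? λ v → all? λ w →
  C₅-adj? u v →-dec (C₅-adj? v w →-dec ¬? (C₅-adj? u w)))

C₅-cliqueNumber : IsCliqueNumber C₅ 2
C₅-cliqueNumber = clique C₅ (_↑ˡ 3) adj , bound
  where
  adj : {u v : Fin 2} → u ≢ v → _~_ C₅ (u ↑ˡ 3) (v ↑ˡ 3)
  adj {u} {v} = from-yes (all? {2} λ u → all? {2} λ v → ¬? (u ≟ v) →-dec C₅-adj? (u ↑ˡ 3) (v ↑ˡ 3)) u v
  bound : ∀ {s} → HasClique C₅ s → s ≤ 2
  bound {0} _ = z≤n
  bound {1} _ = s≤s z≤n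
  bound {2} _ = ℕ.≤-refl
  bound {suc (suc (suc _))} (f , _ , adj) = ⊥-elim
    (C₅-triangle-free (f 0F) (f 1F) (f 2F) (adj λ ()) (adj λ ()) (adj λ ()))

-- With two colours, two steps along a path return to the starting colour; this drives the parity
-- argument on the 5-cycle.
Fin2-≢-≢⇒≡ : {a b c : Fin 2} → a ≢ b → b ≢ c → a ≡ c
Fin2-≢-≢⇒≡ {a} {b} {c} = from-yes (all? {2} λ a → all? {2} λ b → all? {2} λ c →
  ¬? (a ≟ b) →-dec (¬? (b ≟ c) →-dec (a ≟ c))) a b c

C₅-chromaticNumber : IsChromaticNumber C₅ 3
C₅-chromaticNumber = (colour , λ {u} {v} → proper u v) , λ col → ℕ.≰⇒> (few col)
  where
  colour : Fin 5 → Fin 3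
  colour 0F = 0F
  colour 1F = 1F
  colour 2F = 0F
  colour 3F = 1F
  colour 4F = 2F
  proper : ∀ u v → _~_ C₅ u v → colour u ≢ colour v
  proper = from-yes (all? λ u → all? λ v → C₅-adj? u v →-dec ¬? (colour u ≟ colour v))
  few : ∀ {c} → Colourable C₅ c → ¬ (c ≤ 2)
  -- Vertices 0 and 4 both share the colour of vertex 2, yet the wrap-around edge joins them.
  few (f , proper) c≤2 = differ {0F} {4F} (inj₂ (inj₂ (refl , refl)))
    (trans (Fin2-≢-≢⇒≡ (differ {0F} {1F} (inj₁ (inj₁ refl))) (differ {1F} {2F} (inj₁ (inj₁ refl))))
           (Fin2-≢-≢⇒≡ (differ {2F} {3F} (inj₁ (inj₁ refl))) (differ {3F} {4F} (inj₁ (inj₁ refl)))))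
    where
    differ : ∀ {u v} → _~_ C₅ u v → inject≤ (f u) c≤2 ≢ inject≤ (f v) c≤2
    differ u~v = proper u~v ∘ inject≤-injective c≤2 c≤2 _ _

-- Cycles from a path whose first vertex dominates it

module _ (G : Graph) {n : ℕ} (p : Fin (suc n) → V G) (p-inj : Injective _≡_ _≡_ p)
         (consecutive : ∀ a b → toℕ b ≡ suc (toℕ a) → _~_ G (p a) (p b))
         (dominating : ∀ a → _~_ G (p zero) (p (suc a))) where

  path⇒cycle : ∀ {m} → 3 ≤ m → m ≤ suc n → HasCycle G m
  path⇒cycle {suc m} 3≤m m≤n = 3≤m , q , inject≤-injective m≤n m≤n _ _ ∘ p-inj , adj
    where
    q : Fin (suc m) → V G
    q x = p (inject≤ x m≤n)
    next : ∀ x y → Next x y → _~_ G (q x) (q y)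
    next x y (inj₁ y≡1+x) = consecutive _ _
      (trans (toℕ-inject≤ y m≤n) (trans y≡1+x (cong suc (sym (toℕ-inject≤ x m≤n)))))
    -- The closing edge runs from the last vertex of the initial segment back to the dominating
    -- start.
    next (suc x) zero    (inj₂ _)           = ~-sym G (dominating _)
    -- A wrap from the start to itself would mean a cycle of length 1.
    next zero    zero    (inj₂ (1≡1+m , _)) with s≤s () ← subst (3 ≤_) (sym 1≡1+m) 3≤m
    next _       (suc _) (inj₂ (_ , ()))
    adj : ∀ {x y} → Next x y ⊎ Next y x → _~_ G (q x) (q y)
    adj {x} {y} (inj₁ x→y) = next x y x→y
    adj {x} {y} (inj₂ y→x) = ~-sym G (next y x y→x)

-- A spanning path and the cycle lengths of `H (suc i)`

module _ (i : ℕ) where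

  tour : Fin (6 + i) → V (H (suc i))
  tour 0F = inj₁ zero
  tour 1F = inj₂ 0F
  tour 2F = inj₂ 1F
  tour 3F = inj₂ 2F
  tour 4F = inj₂ 3F
  tour 5F = inj₂ 4F
  tour (suc (suc (suc (suc (suc (suc x)))))) = inj₁ (suc x)

  -- A left inverse of `tour`, from which injectivity follows.
  position : V (H (suc i)) → Fin (6 + i)
  position (inj₁ zero)    = 0F
  position (inj₁ (suc x)) = 6 ↑ʳ x
  position (inj₂ y)       = suc (y ↑ˡ i)

  position-tour : ∀ a → position (tour a) ≡ a
  position-tour 0F = refl
  position-tour 1F = refl
  position-tour 2F = refl
  position-tour 3F = refl
  position-tour 4F = refl
  position-tour 5F = refl
  position-tour (suc (suc (suc (suc (suc (suc _)))))) = refl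

  tour-injective : Injective _≡_ _≡_ tour
  tour-injective {a} {b} eq =
    trans (sym (position-tour a)) (trans (cong position eq) (position-tour b))

  tour-consecutive : ∀ a b → toℕ b ≡ suc (toℕ a) → _~_ (H (suc i)) (tour a) (tour b)
  tour-consecutive 0F 1F _ = tt
  tour-consecutive 1F 2F _ = inj₁ (inj₁ refl)
  tour-consecutive 2F 3F _ = inj₁ (inj₁ refl)
  tour-consecutive 3F 4F _ = inj₁ (inj₁ refl)
  tour-consecutive 4F 5F _ = inj₁ (inj₁ refl)
  tour-consecutive 5F (suc (suc (suc (suc (suc (suc _)))))) _ = tt
  -- Adjacency in the complete part is inequality, and equal vertices here would have equal
  -- positions, contrary to `eq`.
  tour-consecutive (suc (suc (suc (suc (suc (suc x)))))) (suc (suc (suc (suc (suc (suc y)))))) eq x≡y =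
    ℕ.1+n≢n (trans (sym eq) (cong ((6 +_) ∘ toℕ) (sym (suc-injective x≡y))))

  tour-dominating : ∀ a → _~_ (H (suc i)) (tour zero) (tour (suc a))
  tour-dominating 0F = tt
  tour-dominating 1F = tt
  tour-dominating 2F = tt
  tour-dominating 3F = tt
  tour-dominating 4F = tt
  tour-dominating (suc (suc (suc (suc (suc _))))) = λ ()

  H-pancyclic : ∀ {m} → 3 ≤ m → m ≤ 6 + i → HasCycle (H (suc i)) m
  H-pancyclic = path⇒cycle (H (suc i)) tour tour-injective tour-consecutive tour-dominating

-- A cycle visits distinct vertices, and there are `i + 5` of them.
H-cycle-≤ : ∀ i {m} → HasCycle (H i) m → m ≤ i + 5
H-cycle-≤ i (_ , f , inj , _) = injective⇒≤ (inj ∘ join-injective i 5)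

-- Odd cycle lengths: 3, 5, ..., 2k + 1

module _ {i k : ℕ} (4+i≡2k : 4 + i ≡ 2 * k) where

  odd : ℕ → ℕ
  odd j = 2 * j + 1

  odd-injective : Injective _≡_ _≡_ odd
  odd-injective eq = ℕ.*-cancelˡ-≡ _ _ 2 (ℕ.+-cancelʳ-≡ 1 _ _ eq)

  odd-cycle⁺ : ∀ {j} → 1 ≤ j → j ≤ k → Lₒ (H (suc i)) (odd j)
  odd-cycle⁺ {j} 1≤j j≤k = (j , refl) , H-pancyclic i (mono 1≤j) (begin
    2 * j + 1     ≤⟨ mono j≤k ⟩
    2 * k + 1     ≡⟨ cong (_+ 1) 4+i≡2k ⟨
    4 + i + 1     ≡⟨ ℕ.+-comm (4 + i) 1 ⟩
    5 + i         ≤⟨ ℕ.n≤1+n _ ⟩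
    6 + i         ∎)
    where
    open ℕ.≤-Reasoning
    mono : ∀ {a b} → a ≤ b → odd a ≤ odd b
    mono a≤b = ℕ.+-monoˡ-≤ 1 (ℕ.*-monoʳ-≤ 2 a≤b)

  -- The graph has `6 + i`, that is 2k + 2, vertices, which bounds the half-length by k. The shift
  -- to `suc j` excludes length 1 and makes the index range match `upTo k`.
  odd-cycle⁻ : ∀ {m} → Lₒ (H (suc i)) m → ∃[ j ] m ≡ odd (suc j) × j < k
  odd-cycle⁻ ((zero , refl) , s≤s () , _)
  odd-cycle⁻ ((suc j , refl) , cyc) = j , refl , s≤s⁻¹ (ℕ.*-cancelˡ-< 2 (suc j) (suc k) (begin
    suc (2 * suc j) ≡⟨ ℕ.+-comm 1 _ ⟩
    2 * suc j + 1   ≤⟨ H-cycle-≤ (suc i) cyc ⟩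
    suc i + 5       ≡⟨ ℕ.+-comm (suc i) 5 ⟩
    2 + (4 + i)     ≡⟨ cong (2 +_) 4+i≡2k ⟩
    2 + 2 * k       ≡⟨ ℕ.*-suc 2 k ⟨
    2 * suc k       ∎))
    where open ℕ.≤-Reasoning

  longestOddCycle : 1 ≤ k → IsLongestOddCycleLength (H (suc i)) (2 * k + 1)
  longestOddCycle 1≤k = odd-cycle⁺ 1≤k ℕ.≤-refl , bound
    where
    bound : ∀ {m} → Lₒ (H (suc i)) m → m ≤ 2 * k + 1
    bound m∈L with _ , refl , j<k ← odd-cycle⁻ m∈L = ℕ.+-monoˡ-≤ 1 (ℕ.*-monoʳ-≤ 2 j<k)

  oddCycle-cardinality : HasCardinality (Lₒ (H (suc i))) k
  oddCycle-cardinality = map (odd ∘ suc) (upTo k) ,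
    map⁺ (ℕ.suc-injective ∘ odd-injective) (upTo⁺ k) ,
    (λ m → mk⇔ to from) ,
    trans (length-map _ (upTo k)) (length-upTo k)
    where
    to : ∀ {m} → m ∈ map (odd ∘ suc) (upTo k) → Lₒ (H (suc i)) m
    to m∈ with _ , j∈ , refl ← ∈-map⁻ (odd ∘ suc) m∈ = odd-cycle⁺ (s≤s z≤n) (∈-upTo⁻ j∈)
    from : ∀ {m} → Lₒ (H (suc i)) m → m ∈ map (odd ∘ suc) (upTo k)
    from m∈L with _ , refl , j<k ← odd-cycle⁻ m∈L = ∈-map⁺ (odd ∘ suc) (∈-upTo⁺ j<k)

mainTheorem8 : (k : ℕ) → 2 ≤ k →
    ∃[ w ] ∃[ n ] ∃[ ℓ ] ∃[ χ ]
    IsCliqueNumber (H (2 * k ∸ 3)) w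
    × HasCardinality (Lₒ (H (2 * k ∸ 3))) n
    × IsLongestOddCycleLength (H (2 * k ∸ 3)) ℓ
    × IsChromaticNumber (H (2 * k ∸ 3)) χ
    × w ≡ 2 * k ∸ 1
    × 2 * n + 1 ≡ ℓ
    × ℓ ≡ 2 * k + 1
    × χ ≡ 2 * k
    × w ≡ 2 * n ∸ 1
    × χ ≡ 2 * n
    × χ ≡ ℓ ∸ 1
mainTheorem8 k 2≤k =
  2 * k ∸ 1 , k , 2 * k + 1 , 2 * k ,
  transport IsCliqueNumber (trans (ℕ.+-comm (suc i) 2) (cong (_∸ 1) 4+i≡2k))
    (cliqueNumber-join C₅ (suc i) C₅-cliqueNumber) ,
  transport (HasCardinality ∘ Lₒ) refl (oddCycle-cardinality 4+i≡2k) ,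
  transport IsLongestOddCycleLength refl
    (longestOddCycle 4+i≡2k (ℕ.≤-trans (s≤s z≤n) 2≤k)) ,
  transport IsChromaticNumber (trans (ℕ.+-comm (suc i) 3) 4+i≡2k)
    (chromaticNumber-join C₅ (suc i) C₅-chromaticNumber) ,
  refl , refl , refl , refl , refl , refl , sym (ℕ.m+n∸n≡m (2 * k) 1)
  where
  i : ℕ
  -- One less than the index `2 * k ∸ 3`, so that the complete part visibly contains an apex;
  -- `2 ≤ k` makes the truncated subtraction exact.
  i = 2 * k ∸ 4
  4+i≡2k : 4 + i ≡ 2 * k
  4+i≡2k = ℕ.m+[n∸m]≡n (ℕ.*-monoʳ-≤ 2 2≤k)
  1+i≡ : suc i ≡ 2 * k ∸ 3
  1+i≡ = cong (_∸ 3) 4+i≡2k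
  -- `suc i` and `2 * k ∸ 3` are only propositionally equal, so the graph index is rewritten
  -- together with the value of the invariant.
  transport : (P : Graph → ℕ → Set) → ∀ {a b} → a ≡ b → P (H (suc i)) a → P (H (2 * k ∸ 3)) b
  transport P {a} refl = subst (λ h → P (H h) a) 1+i≡
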